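{- For all natural numbers $n$ and $k$ with $k\le n$, $\mathrm{E}_k^+=\mathcal{E}_k^n$ and $\mathrm{U}_k^+=\mathcal{U}_k^n$.
   Context: Formulas are those of a first-order language with logical constants $\forall,\exists,\to,\land,\lor,\perp$. Natural numbers may be $0$. Classes $\mathcal{E}^n_k,\mathcal{U}^n_k,\mathcal{D}^n_k$. For each $n$, $\mathcal{D}^n_0=\mathcal{E}^n_0=\mathcal{U}^n_0$ is the set of quantifier-free formulas. Given $\mathcal{E}^n_k$ and $\mathcal{U}^n_k$, put $\mathcal{D}^n_k=\mathcal{E}^n_k\cup\mathcal{U}^n_k$; then $\mathcal{E}^n_{k+1}$ and $\mathcal{U}^n_{k+1}$ are simultaneously inductively generated by the following clauses, where $D$ ranges over $\mathcal{D}^n_k$, $E,E'$ over $\mathcal{E}^n_{k+1}$, and $U,U'$ over $\mathcal{U}^n_{k+1}$: - if $n>k$: $D,\ E\land E',\ E\lor E',\ U\to E,\ \exists xE\in\mathcal{E}^n_{k+1}$; and $D,\ U\land U',\ U\lor U',\ E\to U,\ \forall xU\in\mathcal{U}^n_{k+1}$; - if $n=k$: $D,\ E\land E',\ E\lor E',\ D\to E,\ \exists xE\in\mathcal{E}^n_{k+1}$; and $D,\ U\land U',\ U\lor D,\ D\lor U,\ E\to U,\ \forall xU\in\mathcal{U}^n_{k+1}$; - if $n<k$: with $D_0$ ranging over $\mathcal{D}^n_n$ and $E_1$ over $\mathcal{E}^n_{n+1}$: $D,\ E\land E',\ E\lor E_1,\ E_1\lor E,\ D_0\to E,\ \exists xE\in\mathcal{E}^n_{k+1}$;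 and $D,\ U\land U',\ U\lor D_0,\ D_0\lor U,\ E_1\to U,\ \forall xU\in\mathcal{U}^n_{k+1}$. Classes $\mathrm{E}_k^+,\mathrm{U}_k^+$. An alternation path is a finite sequence in which the symbols $+$ and $-$ alternate; $l(s)$ is its length, $i(s)$ its first symbol (undefined, hence neither $+$ nor $-$, for the empty path $\langle\rangle$), and $s^\perp$ is $s$ with $+$ and $-$ switched. Define $\mathrm{Alt}(\varphi)$: if $\varphi$ is quantifier-free, $\mathrm{Alt}(\varphi)=\{\langle\rangle\}$; otherwise $\mathrm{Alt}(\varphi_1\land\varphi_2)=\mathrm{Alt}(\varphi_1\lor\varphi_2)=\mathrm{Alt}(\varphi_1)\cup\mathrm{Alt}(\varphi_2)$; $\mathrm{Alt}(\varphi_1\to\varphi_2)=\{s^\perp\mid s\in\mathrm{Alt}(\varphi_1)\}\cup\mathrm{Alt}(\varphi_2)$; $\mathrm{Alt}(\forall x\varphi_1)=\{s\in\mathrm{Alt}(\varphi_1)\mid i(s)=-\}\cup\{ -s\mid s\in\mathrm{Alt}(\varphi_1),\,i(s)\neq-\}$; $\mathrm{Alt}(\exists x\varphi_1)=\{s\in\mathrm{Alt}(\varphi_1)\mid i(s)=+\}\cup\{+s\mid s\in\mathrm{Alt}(\varphi_1),\,i(s)\neq+\}$. Let $\deg(\varphi)=\max\{l(s)\mid s\in\mathrm{Alt}(\varphi)\}$, $\mathrm{F}_k=\{\varphi\mid\deg(\varphi)=k\}$, $\mathrm{E}_0=\mathrm{U}_0=\mathrm{F}_0$, $\mathrm{E}_{k+1}$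 (resp. $\mathrm{U}_{k+1}$) the set of $\varphi\in\mathrm{F}_{k+1}$ such that $i(s)=+$ (resp. $i(s)=-$) for all $s\in\mathrm{Alt}(\varphi)$ with $l(s)=k+1$. Then $\mathrm{E}_k^+=\mathrm{E}_k\cup\bigcup_{i<k}\mathrm{F}_i$ and $\mathrm{U}_k^+=\mathrm{U}_k\cup\bigcup_{i<k}\mathrm{F}_i$. -}

module Defs where

open import Data.Bool.Base using (true; false; if_then_else_)
open import Data.Fin.Base using (Fin; toℕ)
open import Data.List.Base using (List; []; _∷_; [_]; _++_; filter; head; length; map)
open import Data.List.Extrema.Nat using (max)
open import Data.List.Membership.Propositional using () renaming (_∈_ to _∈ˡ_)
open import Data.List.Relation.Unary.All as All using (All; []; _∷_)
import Data.List.Relation.Unary.All.Properties as All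
open import Data.List.Relation.Unary.Linked as Linked using (Linked; []; [-]; _∷_)
import Data.List.Relation.Unary.Linked.Properties as Linked
open import Data.Maybe.Base using (Maybe; just)
import Data.Maybe.Properties as Maybe
open import Data.Nat.Base using (ℕ; zero; suc; _<_; _>_)
open import Data.Product.Base using (_×_; _,_; uncurry)
open import Data.Sign.Base using (Sign; +; -; opposite)
import Data.Sign.Properties as Sign
open import Data.Vec.Base using (Vec)
open import Function.Base using (_∘_)
open import Level using (Level; _⊔_) renaming (suc to ℓsuc)
open import Relation.Binary.PropositionalEquality using (_≡_; _≢_; refl; sym; cong)
open import Relation.Nullary.Decidable using (Dec; yes; no; does; map′; _×-dec_; ¬?)
open import Relation.Unary using (Pred; _∈_; _∪_; ⋃)

private
  variable
    f r : Level

------------------------------------------------------------------------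
-- First-order formulas

-- Equality, when present, is one of the relation symbols.
record Signature (f r : Level) : Set (ℓsuc (f ⊔ r)) where
  field
    FunctionSymbol : Set f
    RelationSymbol : Set r
    functionArity  : FunctionSymbol → ℕ
    relationArity  : RelationSymbol → ℕ

open Signature

data Term (L : Signature f r) : Set f where
  var : ℕ → Term L
  app : (g : FunctionSymbol L) → Vec (Term L) (functionArity L g) → Term L

infixr 7 _∧_
infixr 6 _∨_
infixr 5 _⇒_

-- Variables are named: the first argument of all and ex is the bound variable.
data Formula (L : Signature f r) : Set (f ⊔ r) where
  atom        : (R : RelationSymbol L) → Vec (Term L) (relationArity L R) → Formula L
  falsum      : Formula L
  _∧_ _∨_ _⇒_ : Formula L → Formula L → Formula L
  all ex      : ℕ → Formula L → Formula L

data QuantifierFree {L : Signature f r} : Pred (Formula L) (f ⊔ r) where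
  atom   : ∀ {R ts} → QuantifierFree (atom R ts)
  falsum : QuantifierFree falsum
  _∧_    : ∀ {φ ψ} → QuantifierFree φ → QuantifierFree ψ → QuantifierFree (φ ∧ ψ)
  _∨_    : ∀ {φ ψ} → QuantifierFree φ → QuantifierFree ψ → QuantifierFree (φ ∨ ψ)
  _⇒_    : ∀ {φ ψ} → QuantifierFree φ → QuantifierFree ψ → QuantifierFree (φ ⇒ ψ)

quantifierFree? : {L : Signature f r} (φ : Formula L) → Dec (QuantifierFree φ)
quantifierFree? (atom R ts) = yes atom
quantifierFree? falsum      = yes falsum
quantifierFree? (φ ∧ ψ)     = map′ (uncurry _∧_) (λ { (p ∧ q) → p , q })
                                (quantifierFree? φ ×-dec quantifierFree? ψ)
quantifierFree? (φ ∨ ψ)     = map′ (uncurry _∨_) (λ { (p ∨ q) → p , q })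
                                (quantifierFree? φ ×-dec quantifierFree? ψ)
quantifierFree? (φ ⇒ ψ)     = map′ (uncurry _⇒_) (λ { (p ⇒ q) → p , q })
                                (quantifierFree? φ ×-dec quantifierFree? ψ)
quantifierFree? (all x φ)   = no λ ()
quantifierFree? (ex x φ)    = no λ ()

------------------------------------------------------------------------
-- The classes 𝓔ⁿₖ, 𝓤ⁿₖ, 𝓓ⁿₖ

-- Level k+1 refers to lower levels only positively, so generating all levels
-- at once gives the same classes as generating them one after another.  The
-- constructors D, _∧_ and ex (resp. all) are the clauses common to the three
-- cases; the suffixes >, = and < mark the clauses for n > k, n = k and n < k.
mutual
  data 𝓔 {L : Signature f r} (n : ℕ) : ℕ → Pred (Formula L) (f ⊔ r) where
    qf   : ∀ {φ} → QuantifierFree φ → φ ∈ 𝓔 n 0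
    D    : ∀ {k φ} → φ ∈ 𝓓 n k → φ ∈ 𝓔 n (suc k)
    _∧_  : ∀ {k φ ψ} → φ ∈ 𝓔 n (suc k) → ψ ∈ 𝓔 n (suc k) → (φ ∧ ψ) ∈ 𝓔 n (suc k)
    ex   : ∀ {k φ} x → φ ∈ 𝓔 n (suc k) → ex x φ ∈ 𝓔 n (suc k)

    ∨>   : ∀ {k φ ψ} → n > k → φ ∈ 𝓔 n (suc k) → ψ ∈ 𝓔 n (suc k) → (φ ∨ ψ) ∈ 𝓔 n (suc k)
    ⇒>   : ∀ {k φ ψ} → n > k → φ ∈ 𝓤 n (suc k) → ψ ∈ 𝓔 n (suc k) → (φ ⇒ ψ) ∈ 𝓔 n (suc k)

    ∨=   : ∀ {k φ ψ} → n ≡ k → φ ∈ 𝓔 n (suc k) → ψ ∈ 𝓔 n (suc k) → (φ ∨ ψ) ∈ 𝓔 n (suc k)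
    ⇒=   : ∀ {k φ ψ} → n ≡ k → φ ∈ 𝓓 n k → ψ ∈ 𝓔 n (suc k) → (φ ⇒ ψ) ∈ 𝓔 n (suc k)

    ∨<ˡ  : ∀ {k φ ψ} → n < k → φ ∈ 𝓔 n (suc k) → ψ ∈ 𝓔 n (suc n) → (φ ∨ ψ) ∈ 𝓔 n (suc k)
    ∨<ʳ  : ∀ {k φ ψ} → n < k → φ ∈ 𝓔 n (suc n) → ψ ∈ 𝓔 n (suc k) → (φ ∨ ψ) ∈ 𝓔 n (suc k)
    ⇒<   : ∀ {k φ ψ} → n < k → φ ∈ 𝓓 n n → ψ ∈ 𝓔 n (suc k) → (φ ⇒ ψ) ∈ 𝓔 n (suc k)

  data 𝓤 {L : Signature f r} (n : ℕ) : ℕ → Pred (Formula L) (f ⊔ r) where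
    qf   : ∀ {φ} → QuantifierFree φ → φ ∈ 𝓤 n 0
    D    : ∀ {k φ} → φ ∈ 𝓓 n k → φ ∈ 𝓤 n (suc k)
    _∧_  : ∀ {k φ ψ} → φ ∈ 𝓤 n (suc k) → ψ ∈ 𝓤 n (suc k) → (φ ∧ ψ) ∈ 𝓤 n (suc k)
    all  : ∀ {k φ} x → φ ∈ 𝓤 n (suc k) → all x φ ∈ 𝓤 n (suc k)

    ∨>   : ∀ {k φ ψ} → n > k → φ ∈ 𝓤 n (suc k) → ψ ∈ 𝓤 n (suc k) → (φ ∨ ψ) ∈ 𝓤 n (suc k)
    ⇒>   : ∀ {k φ ψ} → n > k → φ ∈ 𝓔 n (suc k) → ψ ∈ 𝓤 n (suc k) → (φ ⇒ ψ) ∈ 𝓤 n (suc k)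

    ∨=ˡ  : ∀ {k φ ψ} → n ≡ k → φ ∈ 𝓤 n (suc k) → ψ ∈ 𝓓 n k → (φ ∨ ψ) ∈ 𝓤 n (suc k)
    ∨=ʳ  : ∀ {k φ ψ} → n ≡ k → φ ∈ 𝓓 n k → ψ ∈ 𝓤 n (suc k) → (φ ∨ ψ) ∈ 𝓤 n (suc k)
    ⇒=   : ∀ {k φ ψ} → n ≡ k → φ ∈ 𝓔 n (suc k) → ψ ∈ 𝓤 n (suc k) → (φ ⇒ ψ) ∈ 𝓤 n (suc k)

    ∨<ˡ  : ∀ {k φ ψ} → n < k → φ ∈ 𝓤 n (suc k) → ψ ∈ 𝓓 n n → (φ ∨ ψ) ∈ 𝓤 n (suc k)
    ∨<ʳ  : ∀ {k φ ψ} → n < k → φ ∈ 𝓓 n n → ψ ∈ 𝓤 n (suc k) → (φ ∨ ψ) ∈ 𝓤 n (suc k)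
    ⇒<   : ∀ {k φ ψ} → n < k → φ ∈ 𝓔 n (suc n) → ψ ∈ 𝓤 n (suc k) → (φ ⇒ ψ) ∈ 𝓤 n (suc k)

  𝓓 : {L : Signature f r} → ℕ → ℕ → Pred (Formula L) (f ⊔ r)
  𝓓 n k = 𝓔 n k ∪ 𝓤 n k

------------------------------------------------------------------------
-- Alternation paths

-- The elements of Alt φ do alternate: see Alt-alternating.
Path : Set
Path = List Sign

Alternating : Pred Path _
Alternating = Linked _≢_

-- The first symbol of a path; it is nothing for the empty path.
i : Path → Maybe Sign
i = head

_^⊥ : Path → Path
s ^⊥ = map opposite s

i≟ : (σ : Sign) (s : Path) → Dec (i s ≡ just σ)
i≟ σ s = Maybe.≡-dec Sign._≟_ (i s) (just σ)

quantify : Sign → List Path → List Path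
quantify σ S = filter (i≟ σ) S ++ map (σ ∷_) (filter (¬? ∘ i≟ σ) S)

-- The finite set Alt(φ) as a list, whose order and multiplicities are irrelevant.
Alt : {L : Signature f r} → Formula L → List Path
Alt (atom R ts) = [ [] ]
Alt falsum      = [ [] ]
Alt (φ ∧ ψ)     = if does (quantifierFree? (φ ∧ ψ)) then [ [] ] else Alt φ ++ Alt ψ
Alt (φ ∨ ψ)     = if does (quantifierFree? (φ ∨ ψ)) then [ [] ] else Alt φ ++ Alt ψ
Alt (φ ⇒ ψ)     = if does (quantifierFree? (φ ⇒ ψ)) then [ [] ] else map _^⊥ (Alt φ) ++ Alt ψ
Alt (all x φ)   = quantify - (Alt φ)
Alt (ex x φ)    = quantify + (Alt φ)

private
  ^⊥-alternating : ∀ {s} → Alternating s → Alternating (s ^⊥)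
  ^⊥-alternating = Linked.map⁺ ∘ Linked.map (_∘ Sign.opposite-injective)

  ∷-alternating : ∀ σ {s} → i s ≢ just σ → Alternating s → Alternating (σ ∷ s)
  ∷-alternating σ {[]}    _ _ = [-]
  ∷-alternating σ {τ ∷ s} p a = (λ σ≡τ → p (cong just (sym σ≡τ))) ∷ a

  quantify-alternating : ∀ σ {S} → All Alternating S → All Alternating (quantify σ S)
  quantify-alternating σ {S} as = All.++⁺
    (All.filter⁺ (i≟ σ) as)
    (All.map⁺ (All.zipWith (λ (p , a) → ∷-alternating σ p a)
      (All.all-filter (¬? ∘ i≟ σ) S , All.filter⁺ (¬? ∘ i≟ σ) as)))

  if-alternating : ∀ b {S} → All Alternating S → All Alternating (if b then [ [] ] else S)
  if-alternating false as = as
  if-alternating true  _  = [] ∷ []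

Alt-alternating : {L : Signature f r} (φ : Formula L) → All Alternating (Alt φ)
Alt-alternating (atom R ts) = [] ∷ []
Alt-alternating falsum      = [] ∷ []
Alt-alternating (φ ∧ ψ)     = if-alternating (does (quantifierFree? (φ ∧ ψ)))
  (All.++⁺ (Alt-alternating φ) (Alt-alternating ψ))
Alt-alternating (φ ∨ ψ)     = if-alternating (does (quantifierFree? (φ ∨ ψ)))
  (All.++⁺ (Alt-alternating φ) (Alt-alternating ψ))
Alt-alternating (φ ⇒ ψ)     = if-alternating (does (quantifierFree? (φ ⇒ ψ)))
  (All.++⁺ (All.map⁺ (All.map ^⊥-alternating (Alt-alternating φ))) (Alt-alternating ψ))
Alt-alternating (all x φ)   = quantify-alternating - (Alt-alternating φ)
Alt-alternating (ex x φ)    = quantify-alternating + (Alt-alternating φ)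

------------------------------------------------------------------------
-- The classes Eₖ⁺, Uₖ⁺

-- Alt φ is never empty, and 0 is neutral for maxima in ℕ.
deg : {L : Signature f r} → Formula L → ℕ
deg φ = max 0 (map length (Alt φ))

F : {L : Signature f r} → ℕ → Pred (Formula L) _
F k φ = deg φ ≡ k

E : {L : Signature f r} → ℕ → Pred (Formula L) _
E zero      = F 0
E (suc k) φ = φ ∈ F (suc k) × (∀ s → s ∈ˡ Alt φ → length s ≡ suc k → i s ≡ just +)

U : {L : Signature f r} → ℕ → Pred (Formula L) _
U zero      = F 0
U (suc k) φ = φ ∈ F (suc k) × (∀ s → s ∈ˡ Alt φ → length s ≡ suc k → i s ≡ just -)

E⁺ : {L : Signature f r} → ℕ → Pred (Formula L) _
E⁺ k = E k ∪ ⋃ (Fin k) (F ∘ toℕ)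

U⁺ : {L : Signature f r} → ℕ → Pred (Formula L) _
U⁺ k = U k ∪ ⋃ (Fin k) (F ∘ toℕ)

{-# OPTIONS --safe #-}

-- A formula φ is in Eₖ⁺ iff every s ∈ Alt(φ) is empty, or has l(s) < k, or has
-- l(s) = k and starts with +; likewise for Uₖ⁺ with -.  At positive levels up to n
-- only the clauses of the first case of the definition of 𝓔ⁿ and 𝓤ⁿ apply, and each
-- of them preserves and reflects this condition on paths.  The one case that needs
-- a lower level is ∃xφ ∈ Uₖ₊₁⁺: all paths of ∃xφ start with +, so they have length
-- at most k and ∃xφ ∈ Eₖ⁺ (dually for ∀xφ ∈ Eₖ₊₁⁺).
module Submission where

open import Defs
open import Data.Bool.Base using (true; false; if_then_else_)
open import Data.Fin.Base using (Fin; toℕ; fromℕ<)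
open import Data.Fin.Properties using (toℕ<n; toℕ-fromℕ<)
open import Data.List.Base using (List; []; _∷_; [_]; length; map)
open import Data.List.Extrema.Nat using (max≤v⁺; xs≤max)
open import Data.List.Membership.Propositional using () renaming (_∈_ to _∈ˡ_)
open import Data.List.Membership.Propositional.Properties
  using (∈-filter⁺; ∈-map⁺; ∈-++⁺ˡ; ∈-++⁺ʳ)
open import Data.List.Properties using (length-map; map-∘; map-cong; map-id)
open import Data.List.Relation.Unary.All as All using (All; []; _∷_)
import Data.List.Relation.Unary.All.Properties as All
open import Data.Maybe.Base using (just)
open import Data.Nat.Base using (ℕ; zero; suc; _≤_; _<_; z≤n; s≤s; z<s; s≤s⁻¹)
open import Data.Nat.Properties
  using (≤-trans; ≤-reflexive; <-asym; <-trans; <⇒≤; <⇒≢; ≤-<-trans; m<n⇒m<1+n; n<1+n; m≤n⇒m<n∨m≡n)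
open import Data.Product.Base using (_×_; _,_)
open import Data.Sign.Base using (Sign; +; -; opposite)
open import Data.Sign.Properties using (opposite-involutive)
open import Data.Sum.Base using (_⊎_; inj₁; inj₂)
open import Function.Base using (_∘_)
open import Level using (Level; 0ℓ)
open import Relation.Binary.PropositionalEquality
  using (_≡_; _≢_; refl; sym; trans; subst)
open import Relation.Nullary.Decidable using (Dec; yes; no; does; dec-true; ¬?)
open import Relation.Nullary.Negation using (¬_; contradiction)
open import Relation.Unary using (Pred; _∈_; _∪_; ⋃; ∅; _⊆_; _≐_)
open import Relation.Unary.Properties using (≐-refl; ≐-trans)

private
  variable
    f r p : Level
    L : Signature f r
    P : Pred Path p
    S : List Path
    s : Path
    σ τ : Sign
    n k : ℕ

-- Paths that fit a sign and a level.

-- The bound in `starts` is on the tail, so that constructor reaches length exactly `k`. `empty`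
-- covers level 0, where the empty path already has the maximal length but no first symbol.
data Fits (σ : Sign) (k : ℕ) : Pred Path 0ℓ where
  empty  : Fits σ k []
  below  : length s < k → Fits σ k s
  starts : length s < k → Fits σ k (σ ∷ s)

Fits-length : Fits σ k s → length s ≤ k
Fits-length empty      = z≤n
Fits-length (below l)  = <⇒≤ l
Fits-length (starts l) = l

-- A length of at most `k` is strictly below `suc k`, so the first symbol stops mattering. The free
-- sign `τ` lets either class of a level pass into either class of the next.
Fits-raise : Fits σ k s → Fits τ (suc k) s
Fits-raise empty      = empty
Fits-raise (below l)  = below (m<n⇒m<1+n l)
Fits-raise (starts l) = below (s≤s l)

-- Without the first symbol `σ`, a fitting path is too short to fill level `suc k`, which leaves
-- room for one more symbol. The level has to be positive: at 0 the empty path fits and `σ ∷ []`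
-- does not.
Fits-prepend : i s ≢ just σ → Fits σ (suc k) s → Fits σ (suc k) (σ ∷ s)
Fits-prepend _ empty      = starts z<s
Fits-prepend _ (below l)  = starts l
Fits-prepend q (starts _) = contradiction refl q

Fits-tail : Fits σ k (σ ∷ s) → Fits σ k s
Fits-tail (below l)  = below (<-trans (n<1+n _) l)
Fits-tail (starts l) = below l

-- A path with the wrong first symbol cannot have the full length `suc k`. Its length is thus at
-- most `k`, and its first symbol `σ` is the right one there.
Fits-lower : σ ≢ τ → i s ≡ just σ → Fits τ (suc k) s → Fits σ k s
Fits-lower {s = _ ∷ _} _   refl (below l)  = starts (s≤s⁻¹ l)
Fits-lower {s = _ ∷ _} σ≢τ refl (starts _) = contradiction refl σ≢τ

^⊥-involutive : ∀ s → (s ^⊥) ^⊥ ≡ s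
^⊥-involutive s = trans (sym (map-∘ s)) (trans (map-cong opposite-involutive s) (map-id s))

Fits-^⊥ : Fits σ k s → Fits (opposite σ) k (s ^⊥)
Fits-^⊥ empty = empty
Fits-^⊥ {s = s} (below l) = below (subst (_< _) (sym (length-map opposite s)) l)
Fits-^⊥ {s = _ ∷ s} (starts l) = starts (subst (_< _) (sym (length-map opposite s)) l)

Fits-^⊥⁻ : ∀ s → Fits σ k (s ^⊥) → Fits (opposite σ) k s
Fits-^⊥⁻ s = subst (Fits _ _) (^⊥-involutive s) ∘ Fits-^⊥

-- Conditions on all paths of a compound formula.

if-All⁺ : ∀ b → P [] → All P S → All P (if b then [ [] ] else S)
if-All⁺ false _ ps = ps
if-All⁺ true  p _  = p ∷ []

-- When the test succeeds the list collapses to the empty path and tells nothing about `S`; what can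
-- be recovered then is `A` itself.
if-All⁻ : {A : Set p} (A? : Dec A) → All P (if does A? then [ [] ] else S) → A ⊎ All P S
if-All⁻ (yes a) _  = inj₁ a
if-All⁻ (no _)  ps = inj₂ ps

quantify-starts : All (λ s → i s ≡ just σ) (quantify σ S)
quantify-starts {σ = σ} {S = S} =
  All.++⁺ (All.all-filter (i≟ σ) S) (All.map⁺ (All.universal (λ _ → refl) _))

quantify⁺ : (∀ {s} → i s ≢ just σ → P s → P (σ ∷ s)) → All P S → All P (quantify σ S)
quantify⁺ {σ = σ} {S = S} prepend ps = All.++⁺
  (All.filter⁺ (i≟ σ) ps)
  (All.map⁺ (All.zipWith (λ (q , p) → prepend q p)
    (All.all-filter (¬? ∘ i≟ σ) S , All.filter⁺ (¬? ∘ i≟ σ) ps)))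

-- Every path of `S` survives in `quantify σ S`, either unchanged or behind one added `σ`.
quantify⁻ : (∀ {s} → P (σ ∷ s) → P s) → All P (quantify σ S) → All P S
quantify⁻ {P = P} {σ = σ} {S = S} tail ps = All.tabulate path
  where
  path : s ∈ˡ S → P s
  path {s} s∈S with i≟ σ s
  ... | yes q = All.lookup ps (∈-++⁺ˡ (∈-filter⁺ (i≟ σ) s∈S q))
  ... | no ¬q = tail (All.lookup ps (∈-++⁺ʳ _ (∈-map⁺ (σ ∷_) (∈-filter⁺ (¬? ∘ i≟ σ) s∈S ¬q))))

Alt-quantifierFree : {φ : Formula L} → QuantifierFree φ → Alt φ ≡ [ [] ]
Alt-quantifierFree atom   = refl
Alt-quantifierFree falsum = refl
Alt-quantifierFree {φ = φ@(_ ∧ _)} q rewrite dec-true (quantifierFree? φ) q = refl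
Alt-quantifierFree {φ = φ@(_ ∨ _)} q rewrite dec-true (quantifierFree? φ) q = refl
Alt-quantifierFree {φ = φ@(_ ⇒ _)} q rewrite dec-true (quantifierFree? φ) q = refl

-- Nonemptiness is phrased as failure of the everywhere false predicate, so that `quantify⁻` applies
-- to it directly. It excludes vacuous truth of conditions on all paths.
Alt-inhabited : (φ : Formula L) → ¬ All ∅ (Alt φ)
Alt-inhabited (atom R ts) (() ∷ _)
Alt-inhabited falsum      (() ∷ _)
Alt-inhabited φ@(ψ ∧ _) ps with if-All⁻ (quantifierFree? φ) ps
... | inj₁ q  = contradiction (subst (All ∅) (Alt-quantifierFree q) ps) λ { (() ∷ _) }
... | inj₂ qs = Alt-inhabited ψ (All.++⁻ˡ (Alt ψ) qs)
Alt-inhabited φ@(ψ ∨ _) ps with if-All⁻ (quantifierFree? φ) ps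
... | inj₁ q  = contradiction (subst (All ∅) (Alt-quantifierFree q) ps) λ { (() ∷ _) }
... | inj₂ qs = Alt-inhabited ψ (All.++⁻ˡ (Alt ψ) qs)
Alt-inhabited φ@(ψ ⇒ χ) ps with if-All⁻ (quantifierFree? φ) ps
... | inj₁ q  = contradiction (subst (All ∅) (Alt-quantifierFree q) ps) λ { (() ∷ _) }
... | inj₂ qs = Alt-inhabited χ (All.++⁻ʳ (map _^⊥ (Alt ψ)) qs)
Alt-inhabited (all x φ) = Alt-inhabited φ ∘ quantify⁻ λ ()
Alt-inhabited (ex x φ)  = Alt-inhabited φ ∘ quantify⁻ λ ()

-- Formulas all of whose paths fit.

AllFit : Sign → ℕ → Pred (Formula L) _
AllFit σ k φ = All (Fits σ k) (Alt φ)

AllFit-quantifierFree : {φ : Formula L} → QuantifierFree φ → AllFit σ k φ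
AllFit-quantifierFree q = subst (All _) (sym (Alt-quantifierFree q)) (empty ∷ [])

AllFit-raise : (φ : Formula L) → AllFit σ k φ → AllFit τ (suc k) φ
AllFit-raise _ = All.map Fits-raise

AllFit-∧⁺ : (φ ψ : Formula L) → AllFit σ k φ → AllFit σ k ψ → AllFit σ k (φ ∧ ψ)
AllFit-∧⁺ φ ψ as bs = if-All⁺ (does (quantifierFree? (φ ∧ ψ))) empty (All.++⁺ as bs)

AllFit-∨⁺ : (φ ψ : Formula L) → AllFit σ k φ → AllFit σ k ψ → AllFit σ k (φ ∨ ψ)
AllFit-∨⁺ φ ψ as bs = if-All⁺ (does (quantifierFree? (φ ∨ ψ))) empty (All.++⁺ as bs)

-- The paths of the antecedent enter with their signs switched. The free sign sits on the antecedent
-- so that `Fits-^⊥` applies without cancelling a double switch.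
AllFit-⇒⁺ : (φ ψ : Formula L) → AllFit σ k φ → AllFit (opposite σ) k ψ → AllFit (opposite σ) k (φ ⇒ ψ)
AllFit-⇒⁺ φ ψ as bs = if-All⁺ (does (quantifierFree? (φ ⇒ ψ))) empty
  (All.++⁺ (All.map⁺ (All.map Fits-^⊥ as)) bs)

AllFit-∧⁻ : (φ ψ : Formula L) → AllFit σ k (φ ∧ ψ) →
            QuantifierFree (φ ∧ ψ) ⊎ (AllFit σ k φ × AllFit σ k ψ)
AllFit-∧⁻ φ ψ ps with if-All⁻ (quantifierFree? (φ ∧ ψ)) ps
... | inj₁ q  = inj₁ q
... | inj₂ qs = inj₂ (All.++⁻ (Alt φ) qs)

AllFit-∨⁻ : (φ ψ : Formula L) → AllFit σ k (φ ∨ ψ) →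
            QuantifierFree (φ ∨ ψ) ⊎ (AllFit σ k φ × AllFit σ k ψ)
AllFit-∨⁻ φ ψ ps with if-All⁻ (quantifierFree? (φ ∨ ψ)) ps
... | inj₁ q  = inj₁ q
... | inj₂ qs = inj₂ (All.++⁻ (Alt φ) qs)

AllFit-⇒⁻ : (φ ψ : Formula L) → AllFit σ k (φ ⇒ ψ) →
            QuantifierFree (φ ⇒ ψ) ⊎ (AllFit (opposite σ) k φ × AllFit σ k ψ)
AllFit-⇒⁻ φ ψ ps with if-All⁻ (quantifierFree? (φ ⇒ ψ)) ps
... | inj₁ q  = inj₁ q
... | inj₂ qs = let as , bs = All.++⁻ (map _^⊥ (Alt φ)) qs in
  inj₂ (All.map (λ {s} → Fits-^⊥⁻ s) (All.map⁻ as) , bs)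

-- This brings a formula that begins with the quantifier of sign `σ` from the `τ` class down to the
-- `σ` class one level lower.
quantify-lower : σ ≢ τ → All (Fits τ (suc k)) (quantify σ S) → All (Fits σ k) (quantify σ S)
quantify-lower {σ = σ} {S = S} σ≢τ ps =
  All.zipWith (λ (q , p) → Fits-lower σ≢τ q p) (quantify-starts {σ} {S} , ps)

-- Only the empty path fits at level 0, whereas every path of a quantified formula has a first
-- symbol. `Alt-inhabited` provides the path on which the two clash.
¬AllFit0-quantify : (φ : Formula L) → ¬ All (Fits τ 0) (quantify σ (Alt φ))
¬AllFit0-quantify {τ = τ} {σ = σ} φ ps = Alt-inhabited φ (quantify⁻ {σ = σ} (λ ())
  (All.zipWith (λ (q , p) → absurd q p) (quantify-starts {σ} {Alt φ} , ps)))
  where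
  absurd : ∀ {s} → i s ≡ just σ → ¬ Fits τ 0 s
  absurd () empty

AllFit0⇒quantifierFree : (φ : Formula L) → AllFit σ 0 φ → QuantifierFree φ
AllFit0⇒quantifierFree (atom R ts) _ = atom
AllFit0⇒quantifierFree falsum      _ = falsum
AllFit0⇒quantifierFree (φ ∧ ψ) ps with AllFit-∧⁻ φ ψ ps
... | inj₁ q         = q
... | inj₂ (as , bs) = AllFit0⇒quantifierFree φ as ∧ AllFit0⇒quantifierFree ψ bs
AllFit0⇒quantifierFree (φ ∨ ψ) ps with AllFit-∨⁻ φ ψ ps
... | inj₁ q         = q
... | inj₂ (as , bs) = AllFit0⇒quantifierFree φ as ∨ AllFit0⇒quantifierFree ψ bs
AllFit0⇒quantifierFree (φ ⇒ ψ) ps with AllFit-⇒⁻ φ ψ ps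
... | inj₁ q         = q
... | inj₂ (as , bs) = AllFit0⇒quantifierFree φ as ⇒ AllFit0⇒quantifierFree ψ bs
AllFit0⇒quantifierFree (all x φ) ps = contradiction ps (¬AllFit0-quantify φ)
AllFit0⇒quantifierFree (ex x φ)  ps = contradiction ps (¬AllFit0-quantify φ)

-- The inductive classes up to level `n`.

mutual
  -- Induction on the derivation. At level `suc k` the bound is by definition `k < n`, which refutes
  -- the side conditions `n ≡ k` and `n < k`.
  𝓔⇒AllFit : {φ : Formula L} → k ≤ n → φ ∈ 𝓔 n k → AllFit + k φ
  𝓔⇒AllFit k≤n (qf q)                 = AllFit-quantifierFree q
  𝓔⇒AllFit k<n (D {φ = φ} (inj₁ d))   = AllFit-raise φ (𝓔⇒AllFit (<⇒≤ k<n) d)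
  𝓔⇒AllFit k<n (D {φ = φ} (inj₂ d))   = AllFit-raise φ (𝓤⇒AllFit (<⇒≤ k<n) d)
  𝓔⇒AllFit k<n (_∧_ {φ = φ} {ψ} d e)  = AllFit-∧⁺ φ ψ (𝓔⇒AllFit k<n d) (𝓔⇒AllFit k<n e)
  𝓔⇒AllFit k<n (ex x d)               = quantify⁺ Fits-prepend (𝓔⇒AllFit k<n d)
  𝓔⇒AllFit k<n (∨> {φ = φ} {ψ} _ d e) = AllFit-∨⁺ φ ψ (𝓔⇒AllFit k<n d) (𝓔⇒AllFit k<n e)
  𝓔⇒AllFit k<n (⇒> {φ = φ} {ψ} _ d e) = AllFit-⇒⁺ φ ψ (𝓤⇒AllFit k<n d) (𝓔⇒AllFit k<n e)
  𝓔⇒AllFit k<n (∨= n≡k _ _)           = contradiction (sym n≡k) (<⇒≢ k<n)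
  𝓔⇒AllFit k<n (⇒= n≡k _ _)           = contradiction (sym n≡k) (<⇒≢ k<n)
  𝓔⇒AllFit k<n (∨<ˡ n<k _ _)          = contradiction n<k (<-asym k<n)
  𝓔⇒AllFit k<n (∨<ʳ n<k _ _)          = contradiction n<k (<-asym k<n)
  𝓔⇒AllFit k<n (⇒< n<k _ _)           = contradiction n<k (<-asym k<n)

  𝓤⇒AllFit : {φ : Formula L} → k ≤ n → φ ∈ 𝓤 n k → AllFit - k φ
  𝓤⇒AllFit k≤n (qf q)                 = AllFit-quantifierFree q
  𝓤⇒AllFit k<n (D {φ = φ} (inj₁ d))   = AllFit-raise φ (𝓔⇒AllFit (<⇒≤ k<n) d)
  𝓤⇒AllFit k<n (D {φ = φ} (inj₂ d))   = AllFit-raise φ (𝓤⇒AllFit (<⇒≤ k<n) d)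
  𝓤⇒AllFit k<n (_∧_ {φ = φ} {ψ} d e)  = AllFit-∧⁺ φ ψ (𝓤⇒AllFit k<n d) (𝓤⇒AllFit k<n e)
  𝓤⇒AllFit k<n (all x d)              = quantify⁺ Fits-prepend (𝓤⇒AllFit k<n d)
  𝓤⇒AllFit k<n (∨> {φ = φ} {ψ} _ d e) = AllFit-∨⁺ φ ψ (𝓤⇒AllFit k<n d) (𝓤⇒AllFit k<n e)
  𝓤⇒AllFit k<n (⇒> {φ = φ} {ψ} _ d e) = AllFit-⇒⁺ φ ψ (𝓔⇒AllFit k<n d) (𝓤⇒AllFit k<n e)
  𝓤⇒AllFit k<n (∨=ˡ n≡k _ _)          = contradiction (sym n≡k) (<⇒≢ k<n)
  𝓤⇒AllFit k<n (∨=ʳ n≡k _ _)          = contradiction (sym n≡k) (<⇒≢ k<n)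
  𝓤⇒AllFit k<n (⇒= n≡k _ _)           = contradiction (sym n≡k) (<⇒≢ k<n)
  𝓤⇒AllFit k<n (∨<ˡ n<k _ _)          = contradiction n<k (<-asym k<n)
  𝓤⇒AllFit k<n (∨<ʳ n<k _ _)          = contradiction n<k (<-asym k<n)
  𝓤⇒AllFit k<n (⇒< n<k _ _)           = contradiction n<k (<-asym k<n)

𝓔-quantifierFree : {φ : Formula L} → ∀ k → QuantifierFree φ → φ ∈ 𝓔 n k
𝓔-quantifierFree zero    q = qf q
𝓔-quantifierFree (suc k) q = D (inj₁ (𝓔-quantifierFree k q))

𝓤-quantifierFree : {φ : Formula L} → ∀ k → QuantifierFree φ → φ ∈ 𝓤 n k
𝓤-quantifierFree zero    q = qf q
𝓤-quantifierFree (suc k) q = D (inj₂ (𝓤-quantifierFree k q))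

mutual
  -- The recursion is lexicographic in level and formula: most cases keep the level and pass to
  -- subformulas, while a quantifier of the opposite sign keeps the formula and lowers the level.
  AllFit⇒𝓔 : ∀ k (φ : Formula L) → k ≤ n → AllFit + k φ → φ ∈ 𝓔 n k
  AllFit⇒𝓔 zero    φ           _   ps = qf (AllFit0⇒quantifierFree φ ps)
  AllFit⇒𝓔 (suc k) (atom R ts) _   _  = 𝓔-quantifierFree _ atom
  AllFit⇒𝓔 (suc k) falsum      _   _  = 𝓔-quantifierFree _ falsum
  AllFit⇒𝓔 (suc k) (φ ∧ ψ)     k<n ps with AllFit-∧⁻ φ ψ ps
  ... | inj₁ q         = 𝓔-quantifierFree _ q
  ... | inj₂ (as , bs) = AllFit⇒𝓔 _ φ k<n as ∧ AllFit⇒𝓔 _ ψ k<n bs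
  AllFit⇒𝓔 (suc k) (φ ∨ ψ)     k<n ps with AllFit-∨⁻ φ ψ ps
  ... | inj₁ q         = 𝓔-quantifierFree _ q
  ... | inj₂ (as , bs) = ∨> k<n (AllFit⇒𝓔 _ φ k<n as) (AllFit⇒𝓔 _ ψ k<n bs)
  AllFit⇒𝓔 (suc k) (φ ⇒ ψ)     k<n ps with AllFit-⇒⁻ φ ψ ps
  ... | inj₁ q         = 𝓔-quantifierFree _ q
  ... | inj₂ (as , bs) = ⇒> k<n (AllFit⇒𝓤 _ φ k<n as) (AllFit⇒𝓔 _ ψ k<n bs)
  AllFit⇒𝓔 (suc k) (all x φ)   k<n ps =
    D (inj₂ (AllFit⇒𝓤 k (all x φ) (<⇒≤ k<n) (quantify-lower {S = Alt φ} (λ ()) ps)))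
  AllFit⇒𝓔 (suc k) (ex x φ)    k<n ps = ex x (AllFit⇒𝓔 _ φ k<n (quantify⁻ Fits-tail ps))

  AllFit⇒𝓤 : ∀ k (φ : Formula L) → k ≤ n → AllFit - k φ → φ ∈ 𝓤 n k
  AllFit⇒𝓤 zero    φ           _   ps = qf (AllFit0⇒quantifierFree φ ps)
  AllFit⇒𝓤 (suc k) (atom R ts) _   _  = 𝓤-quantifierFree _ atom
  AllFit⇒𝓤 (suc k) falsum      _   _  = 𝓤-quantifierFree _ falsum
  AllFit⇒𝓤 (suc k) (φ ∧ ψ)     k<n ps with AllFit-∧⁻ φ ψ ps
  ... | inj₁ q         = 𝓤-quantifierFree _ q
  ... | inj₂ (as , bs) = AllFit⇒𝓤 _ φ k<n as ∧ AllFit⇒𝓤 _ ψ k<n bs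
  AllFit⇒𝓤 (suc k) (φ ∨ ψ)     k<n ps with AllFit-∨⁻ φ ψ ps
  ... | inj₁ q         = 𝓤-quantifierFree _ q
  ... | inj₂ (as , bs) = ∨> k<n (AllFit⇒𝓤 _ φ k<n as) (AllFit⇒𝓤 _ ψ k<n bs)
  AllFit⇒𝓤 (suc k) (φ ⇒ ψ)     k<n ps with AllFit-⇒⁻ φ ψ ps
  ... | inj₁ q         = 𝓤-quantifierFree _ q
  ... | inj₂ (as , bs) = ⇒> k<n (AllFit⇒𝓔 _ φ k<n as) (AllFit⇒𝓤 _ ψ k<n bs)
  AllFit⇒𝓤 (suc k) (all x φ)   k<n ps = all x (AllFit⇒𝓤 _ φ k<n (quantify⁻ Fits-tail ps))
  AllFit⇒𝓤 (suc k) (ex x φ)    k<n ps =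
    D (inj₁ (AllFit⇒𝓔 k (ex x φ) (<⇒≤ k<n) (quantify-lower {S = Alt φ} (λ ()) ps)))

-- The classes given by degree.

-- Leading + k and Leading - k unfold to E k and U k only once k is zero or a successor.
Leading : Sign → ℕ → Pred (Formula L) _
Leading σ zero      = F 0
Leading σ (suc k) φ = φ ∈ F (suc k) × (∀ s → s ∈ˡ Alt φ → length s ≡ suc k → i s ≡ just σ)

Leading⁺ : Sign → ℕ → Pred (Formula L) _
Leading⁺ σ k = Leading σ k ∪ ⋃ (Fin k) (F ∘ toℕ)

E⁺≐Leading⁺ : ∀ k → E⁺ {L = L} k ≐ Leading⁺ + k
E⁺≐Leading⁺ zero    = ≐-refl
E⁺≐Leading⁺ (suc k) = ≐-refl

U⁺≐Leading⁺ : ∀ k → U⁺ {L = L} k ≐ Leading⁺ - k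
U⁺≐Leading⁺ zero    = ≐-refl
U⁺≐Leading⁺ (suc k) = ≐-refl

length≤deg : (φ : Formula L) → All (λ s → length s ≤ deg φ) (Alt φ)
length≤deg φ = All.map⁻ (xs≤max 0 (map length (Alt φ)))

Fits-maximal : length s ≤ suc k → (length s ≡ suc k → i s ≡ just σ) → Fits σ (suc k) s
Fits-maximal {s = []}    _ _ = empty
Fits-maximal {s = _ ∷ _} l h with m≤n⇒m<n∨m≡n l
... | inj₁ l′ = below l′
-- At full length the hypothesis forces the first symbol, and `l` is by definition also the strict
-- bound on the tail.
... | inj₂ e with refl ← h e = starts l

Fits-zero : length s ≤ 0 → Fits σ 0 s
Fits-zero {s = []} _ = empty

Fits-head : Fits σ (suc k) s → length s ≡ suc k → i s ≡ just σ
Fits-head (below l)  e = contradiction e (<⇒≢ l)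
Fits-head (starts _) _ = refl

Leading⇒AllFit : ∀ k → Leading {L = L} σ k ⊆ AllFit σ k
Leading⇒AllFit zero {φ} d =
  All.map (λ l → Fits-zero (≤-trans l (≤-reflexive d))) (length≤deg φ)
Leading⇒AllFit (suc k) {φ} (d , h) = All.tabulate λ {s} s∈ →
  Fits-maximal (≤-trans (All.lookup (length≤deg φ) s∈) (≤-reflexive d)) (h s s∈)

Leading⁺⇒AllFit : ∀ k → Leading⁺ {L = L} σ k ⊆ AllFit σ k
Leading⁺⇒AllFit k     (inj₁ h)       = Leading⇒AllFit k h
-- A degree strictly below `k` puts every path below `k`, whatever its first symbol.
Leading⁺⇒AllFit k {φ} (inj₂ (j , d)) =
  All.map (λ l → below (≤-<-trans (≤-trans l (≤-reflexive d)) (toℕ<n j))) (length≤deg φ)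

AllFit⇒Leading : ∀ k (φ : Formula L) → deg φ ≡ k → AllFit σ k φ → Leading σ k φ
AllFit⇒Leading zero    φ d _  = d
AllFit⇒Leading (suc k) φ d ps = d , λ s s∈ → Fits-head (All.lookup ps s∈)

AllFit⇒Leading⁺ : ∀ k → AllFit {L = L} σ k ⊆ Leading⁺ σ k
AllFit⇒Leading⁺ k {φ} ps
  -- The degree is at most `k`, with `z≤n` bounding the default value 0 of the maximum. If it is
  -- smaller, the degree itself is the index into the union.
  with m≤n⇒m<n∨m≡n (max≤v⁺ {xs = map length (Alt φ)} z≤n (All.map⁺ (All.map Fits-length ps)))
... | inj₁ l = inj₂ (fromℕ< l , sym (toℕ-fromℕ< l))
... | inj₂ d = inj₁ (AllFit⇒Leading k φ d ps)

Leading⁺≐AllFit : ∀ k → Leading⁺ {L = L} σ k ≐ AllFit σ k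
Leading⁺≐AllFit k = Leading⁺⇒AllFit k , AllFit⇒Leading⁺ k

proposition2p10 : ∀ {f r : Level} (L : Signature f r) (n k : ℕ) → k ≤ n →
    (E⁺ {L = L} k ≐ 𝓔 n k) × (U⁺ {L = L} k ≐ 𝓤 n k)
proposition2p10 L n k k≤n =
  ≐-trans (E⁺≐Leading⁺ k) (≐-trans (Leading⁺≐AllFit k) (AllFit⇒𝓔 k _ k≤n , 𝓔⇒AllFit k≤n)) ,
  ≐-trans (U⁺≐Leading⁺ k) (≐-trans (Leading⁺≐AllFit k) (AllFit⇒𝓤 k _ k≤n , 𝓤⇒AllFit k≤n))
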